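{- Let $a,b\ge 1$ and $k\ge 0$ be integers. If $\left(\frac{k+3}{2}\right)^2 \le \min(a,b)$, then the simplicial complex $\Delta(a,b)$ is not weakly $k$-decomposable.
   Context: For a simplicial complex $\Delta$ and a face $\tau\in\Delta$, the deletion is $\Delta\setminus\tau=\{\sigma\in\Delta:\tau\not\subseteq\sigma\}$. A simplicial complex is pure if all its facets (maximal faces) have the same dimension; the dimension of a face $\tau$ is $|\tau|-1$. Let $\Delta$ be a $(d-1)$-dimensional simplicial complex and $0\le k\le d-1$. Then $\Delta$ is weakly $k$-decomposable if it is pure and either $\Delta$ is a $(d-1)$-simplex (i.e. has a single facet) or there exists a face $\tau\in\Delta$ with $\dim\tau\le k$ such that $\Delta\setminus\tau$ is $(d-1)$-dimensional and weakly $k$-decomposable. Definition of $\Delta(a,b)$: for integers $a,b\ge1$, let $n=a+b+1$ and let $P$ be the $2\times n$ transportation polytope consisting of all real nonnegative $2\times n$ matrices $X=(x_{\mu,\nu})$ with row sums $\sum_\nu x_{1,\nu}=2a+1$, $\sum_\nu x_{2,\nu}=2b+1$ and all column sums $x_{1,\nu}+x_{2,\nu}=2$. This is a simple polytope of dimension $a+b$ whose facets are exactly the sets $F_{\mu,\nu}=\{X\in P: x_{\mu,\nu}=0\}$, $\mu\in\{1,2\}$, $\nu\in[n]$. $\Delta(a,b)$ is the boundary complex of the polar (simplicial) polytope of $P$. Equivalently, its vertex set is $U\cup V$ with $U=\{u_1,\dots,u_n\}$, $V=\{v_1,\dots,v_n\}$ ($u_\nu$ polar to $F_{1,\nu}$,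 $v_\nu$ polar to $F_{2,\nu}$), and a set of vertices is a face iff the corresponding facets of $P$ have nonempty common intersection. -}

module Defs where

open import Data.Nat using (ℕ; zero; suc; _+_; _*_; _≤_; _⊔_)
open import Data.Fin using (Fin; _↑ˡ_; _↑ʳ_) renaming (zero to fzero; suc to fsuc)
open import Data.Fin.Subset using (Subset; _⊆_; _∈_; ∣_∣)
open import Data.Product using (Σ; _×_; _,_; ∃)
open import Data.Integer using (+_)
import Data.Rational as Q
open Q using (ℚ; 0ℚ)
open import Relation.Binary.PropositionalEquality using (_≡_)
open import Relation.Nullary using (¬_)

Complex : ℕ → Set₁
Complex m = Subset m → Set

_∖_ : ∀ {m} → Complex m → Subset m → Complex m
(Δ ∖ τ) σ = Δ σ × ¬ (τ ⊆ σ)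

IsFacet : ∀ {m} → Complex m → Subset m → Set
IsFacet Δ σ = Δ σ × (∀ ρ → Δ ρ → σ ⊆ ρ → ρ ≡ σ)

-- Δ is pure and (d-1)-dimensional: it has a face with d vertices and
-- every facet has exactly d vertices (dim = number of vertices - 1).
PureOfDim : ∀ {m} → ℕ → Complex m → Set
PureOfDim d Δ = (Σ _ λ σ → Δ σ × ∣ σ ∣ ≡ d) × (∀ σ → IsFacet Δ σ → ∣ σ ∣ ≡ d)

IsSimplex : ∀ {m} → Complex m → Set
IsSimplex Δ = Σ _ λ σ → IsFacet Δ σ × (∀ ρ → IsFacet Δ ρ → ρ ≡ σ)

-- Weakly k-decomposable, for a (d-1)-dimensional complex Δ.
-- (dim τ ≤ k  ⇔  ∣τ∣ ≤ k + 1)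
data WeaklyDecomposable {m} (k d : ℕ) : Complex m → Set₁ where
  simplex : ∀ {Δ} → PureOfDim d Δ → IsSimplex Δ → WeaklyDecomposable k d Δ
  shed    : ∀ {Δ} → PureOfDim d Δ → (τ : Subset m) → Δ τ → ∣ τ ∣ ≤ k + 1
          → PureOfDim d (Δ ∖ τ)
          → WeaklyDecomposable k d (Δ ∖ τ)
          → WeaklyDecomposable k d Δ

sumℚ : ∀ {n} → (Fin n → ℚ) → ℚ
sumℚ {zero}  f = 0ℚ
sumℚ {suc n} f = f fzero Q.+ sumℚ (λ i → f (fsuc i))

ℕ→ℚ : ℕ → ℚ
ℕ→ℚ k = (+ k) Q./ 1

InP : (a b : ℕ) → (Fin 2 → Fin (a + b + 1) → ℚ) → Set
InP a b X =
    (∀ μ ν → 0ℚ Q.≤ X μ ν)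
  × sumℚ (X fzero) ≡ ℕ→ℚ (2 * a + 1)
  × sumℚ (X (fsuc fzero)) ≡ ℕ→ℚ (2 * b + 1)
  × (∀ ν → X fzero ν Q.+ X (fsuc fzero) ν ≡ ℕ→ℚ 2)

uVert : ∀ {n} → Fin n → Fin (n + n)
uVert {n} ν = ν ↑ˡ n

vVert : ∀ {n} → Fin n → Fin (n + n)
vVert {n} ν = n ↑ʳ ν

-- σ is a face iff the corresponding facets F_{1,ν} (ν with u_ν ∈ σ) and
-- F_{2,ν} (ν with v_ν ∈ σ) have a common point of P.
Δab : (a b : ℕ) → Complex ((a + b + 1) + (a + b + 1))
Δab a b σ = ∃ λ X → InP a b X
  × (∀ ν → uVert ν ∈ σ → X fzero ν ≡ 0ℚ)
  × (∀ ν → vVert ν ∈ σ → X (fsuc fzero) ν ≡ 0ℚ)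

{-# OPTIONS --safe #-}
module Submission where

-- A set of u's and v's is a face iff no column occurs in it as both u and v and
-- it has at most b u's and at most a v's. During a shedding sequence let 𝒮 and 𝒯
-- be the shed faces consisting of u's only, resp. of v's only. While 𝒮 has a
-- common vertex y, all the a + b > b vertices u_x with x ≠ y survive, so the
-- complex is not a simplex. Hence at some point one of the families, say 𝒮,
-- loses its last common vertex while 𝒯 still has one, y. A minimal subfamily of
-- 𝒮 without common vertex has a union W of at most ((k + 3) / 2)² ≤ b vertices,
-- so some a-set B avoids W and y. Then B, as a set of v's, is a face; a facet
-- containing it has as u-part the complement of B minus one column c, hence
-- contains every S ⊆ W from 𝒮 with c ∉ S. Such an S exists, so purity fails.

open import Defs
import Data.Bool.Properties as Bool
open import Data.Empty using () renaming (⊥ to False)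
open import Data.Fin using (Fin; _↑ˡ_; _↑ʳ_) renaming (zero to fzero; suc to fsuc)
open import Data.Fin.Properties using (any?)
open import Data.Fin.Subset
  using (Subset; inside; outside; _∈_; _∉_; _⊆_; _⊈_; ⊥; ⁅_⁆; ∁; _∪_; _─_; ⋃; ∣_∣; Nonempty; Empty)
open import Data.Fin.Subset.Properties
open import Data.Integer as ℤ using (+≤+)
import Data.Integer.Properties as ℤ
open import Data.List as List using (List; []; _∷_; length; map)
open import Data.List.Membership.Propositional using (find) renaming (_∈_ to _∈ₗ_)
open import Data.List.Membership.Propositional.Properties using (∈-map⁺)
open import Data.List.Relation.Unary.All as All using (All; []; _∷_; all?)
open import Data.List.Relation.Unary.All.Properties using (++⁺; ++⁻ˡ; ++⁻ʳ; ¬All⇒Any¬)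
open import Data.List.Relation.Unary.Any as Any using ()
open import Data.Nat using (ℕ; zero; suc; _+_; _*_; _∸_; _≤_; _⊓_; _<_; z≤n; s≤s; s≤s⁻¹)
open import Data.Nat.Properties
open import Data.Nat.Tactic.RingSolver using (solve-∀)
open import Data.Product using (∃; ∃-syntax; _×_; _,_; proj₁; proj₂)
open import Data.Rational as ℚ using (ℚ; 0ℚ)
import Data.Rational.Properties as ℚ
open import Data.Rational.Unnormalised as ℚᵘ using (mkℚᵘ; *≡*; *≤*)
import Data.Rational.Unnormalised.Properties as ℚᵘ
open import Data.Sum using (inj₁; inj₂; [_,_]′)
open import Data.Vec using ([]; _∷_; here; there; _++_; take; drop)
open import Data.Vec.Functional using () renaming (_∷_ to _◂_)
open import Data.Vec.Properties
  using ([]=⇒lookup; lookup⇒[]=; lookup-++ˡ; lookup-++ʳ; take++drop≡id; ≡-dec)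
open import Function using (_∘_; flip)
open import Relation.Binary.PropositionalEquality
open import Relation.Nullary using (¬_; Dec; yes; no; contradiction)
open import Relation.Nullary.Decidable using (decidable-stable)

-- Cardinalities of subsets.

∣p∪q∣≤∣p∣+∣q∣ : ∀ {n} (p q : Subset n) → ∣ p ∪ q ∣ ≤ ∣ p ∣ + ∣ q ∣
∣p∪q∣≤∣p∣+∣q∣ [] [] = z≤n
∣p∪q∣≤∣p∣+∣q∣ (outside ∷ p) (outside ∷ q) = ∣p∪q∣≤∣p∣+∣q∣ p q
∣p∪q∣≤∣p∣+∣q∣ (outside ∷ p) (inside ∷ q) =
  ≤-trans (s≤s (∣p∪q∣≤∣p∣+∣q∣ p q)) (≤-reflexive (sym (+-suc ∣ p ∣ ∣ q ∣)))
∣p∪q∣≤∣p∣+∣q∣ (inside ∷ p) (outside ∷ q) = s≤s (∣p∪q∣≤∣p∣+∣q∣ p q)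
∣p∪q∣≤∣p∣+∣q∣ (inside ∷ p) (inside ∷ q) =
  s≤s (≤-trans (∣p∪q∣≤∣p∣+∣q∣ p q) (+-monoʳ-≤ ∣ p ∣ (n≤1+n ∣ q ∣)))

∣p∣+∣q∣≤∣p∪q∣ : ∀ {n} (p q : Subset n) → (∀ {x} → x ∈ p → x ∉ q) → ∣ p ∣ + ∣ q ∣ ≤ ∣ p ∪ q ∣
∣p∣+∣q∣≤∣p∪q∣ [] [] _ = z≤n
∣p∣+∣q∣≤∣p∪q∣ (outside ∷ p) (outside ∷ q) dis = ∣p∣+∣q∣≤∣p∪q∣ p q (λ x y → dis (there x) (there y))
∣p∣+∣q∣≤∣p∪q∣ (outside ∷ p) (inside ∷ q) dis =
  ≤-trans (≤-reflexive (+-suc ∣ p ∣ ∣ q ∣)) (s≤s (∣p∣+∣q∣≤∣p∪q∣ p q (λ x y → dis (there x) (there y))))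
∣p∣+∣q∣≤∣p∪q∣ (inside ∷ p) (outside ∷ q) dis = s≤s (∣p∣+∣q∣≤∣p∪q∣ p q (λ x y → dis (there x) (there y)))
∣p∣+∣q∣≤∣p∪q∣ (inside ∷ p) (inside ∷ q) dis = contradiction here (dis here)

∣p∣+∣∁p∣≡n : ∀ {n} (p : Subset n) → ∣ p ∣ + ∣ ∁ p ∣ ≡ n
∣p∣+∣∁p∣≡n p = trans (cong (∣ p ∣ +_) (∣∁p∣≡n∸∣p∣ p)) (m+[n∸m]≡n (∣p∣≤n p))

x∈p─q⇒x∉q : ∀ {n} (p q : Subset n) {x} → x ∈ p ─ q → x ∉ q
x∈p─q⇒x∉q (_ ∷ p) (outside ∷ q) (there x∈) (there x∈q) = x∈p─q⇒x∉q p q x∈ x∈q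
x∈p─q⇒x∉q (_ ∷ p) (inside ∷ q) (there x∈) (there x∈q) = x∈p─q⇒x∉q p q x∈ x∈q

-- Both sides count the union. With `p` a shed set and `q` the witnesses, of which it misses at most
-- one, this bounds the vertices of the shed set that are not witnesses.
∣p─q∣+∣q∣≤∣p∣+∣q─p∣ : ∀ {n} (p q : Subset n) → ∣ p ─ q ∣ + ∣ q ∣ ≤ ∣ p ∣ + ∣ q ─ p ∣
∣p─q∣+∣q∣≤∣p∣+∣q─p∣ p q = begin
  ∣ p ─ q ∣ + ∣ q ∣      ≤⟨ ∣p∣+∣q∣≤∣p∪q∣ (p ─ q) q (x∈p─q⇒x∉q p q) ⟩
  ∣ (p ─ q) ∪ q ∣        ≤⟨ p⊆q⇒∣p∣≤∣q∣ incl ⟩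
  ∣ p ∪ (q ─ p) ∣        ≤⟨ ∣p∪q∣≤∣p∣+∣q∣ p (q ─ p) ⟩
  ∣ p ∣ + ∣ q ─ p ∣      ∎
  where
  open ≤-Reasoning
  incl : (p ─ q) ∪ q ⊆ p ∪ (q ─ p)
  incl {x} x∈ with x ∈? p
  ... | yes x∈p = x∈p∪q⁺ (inj₁ x∈p)
  ... | no  x∉p with x∈p∪q⁻ (p ─ q) q x∈
  ...   | inj₁ x∈p─q = contradiction (p─q⊆p p q x∈p─q) x∉p
  ...   | inj₂ x∈q   = x∈p∪q⁺ (inj₂ (x∈p∧x∉q⇒x∈p─q x∈q x∉p))

subsetOfSize : ∀ {n} k (p : Subset n) → k ≤ ∣ p ∣ → ∃[ q ] q ⊆ p × ∣ q ∣ ≡ k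
subsetOfSize {n} zero p _ = ⊥ , ⊥⊆ , ∣⊥∣≡0 n
subsetOfSize (suc k) (inside ∷ p) k≤ with subsetOfSize k p (s≤s⁻¹ k≤)
... | q , q⊆p , eq = inside ∷ q , in⊆in q⊆p , cong suc eq
subsetOfSize (suc k) (outside ∷ p) k≤ with subsetOfSize (suc k) p k≤
... | q , q⊆p , eq = outside ∷ q , out⊆ q⊆p , eq

∣p∣≡1⇒singleton : ∀ {n} (p : Subset n) → ∣ p ∣ ≡ 1 → ∃[ c ] ∀ {x} → x ∈ p → x ≡ c
∣p∣≡1⇒singleton (outside ∷ p) eq with ∣p∣≡1⇒singleton p eq
... | c , all = fsuc c , λ { (there x∈p) → cong fsuc (all x∈p) }
∣p∣≡1⇒singleton {suc n} (inside ∷ p) eq = fzero , λ where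
  here        → refl
  (there {i = x} x∈p) → contradiction
    (≤-trans (≤-reflexive (sym (∣⁅x⁆∣≡1 x)))
      (p⊆q⇒∣p∣≤∣q∣ (λ y∈ → subst (_∈ p) (sym (x∈⁅y⁆⇒x≡y x y∈)) x∈p)))
    (subst (λ m → ¬ (1 ≤ m)) (sym (suc-injective eq)) λ ())

-- Minimal subfamilies without a common vertex.

⋃-upper : ∀ {n} {S : Subset n} {𝒮} → S ∈ₗ 𝒮 → S ⊆ ⋃ 𝒮
⋃-upper {𝒮 = T ∷ 𝒮} (Any.here refl) = p⊆p∪q (⋃ 𝒮)
⋃-upper {𝒮 = T ∷ 𝒮} (Any.there S∈) = q⊆p∪q T (⋃ 𝒮) ∘ ⋃-upper S∈

Common : ∀ {n} → List (Subset n) → Fin n → Set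
Common 𝒮 y = All (y ∈_) 𝒮

-- P collects one witness per kept set: a vertex of every other surviving set
-- that the kept set itself misses.
prune : ∀ {n} {𝒮 : List (Subset n)} (P : Subset n) kept rest →
  (∀ y → Common kept y → ¬ Common rest y) →
  length kept ≤ ∣ P ∣ →
  All (λ S → S ∈ₗ 𝒮 × ∃[ p ] P ─ S ⊆ ⁅ p ⁆) kept →
  All (λ S → S ∈ₗ 𝒮 × P ⊆ S) rest →
  ∃[ Q ] ∃[ core ] (¬ ∃ (Common core)) × length core ≤ ∣ Q ∣
    × All (λ S → S ∈ₗ 𝒮 × ∃[ p ] Q ─ S ⊆ ⁅ p ⁆) core
prune P kept [] none len keptP _ =
  P , kept , (λ (y , cy) → none y cy []) , len , keptP
prune {𝒮 = 𝒮} P kept (S ∷ rest) none len keptP ((S∈ , P⊆S) ∷ restP)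
  with any? (λ y → all? (y ∈?_) (kept List.++ rest))
... | no ¬c = prune P kept rest (λ y k r → ¬c (y , ++⁺ k r)) len keptP restP
-- Here `p` lies in all other surviving sets, hence not in `S`: it is the witness for keeping `S`.
... | yes (p , cp) =
  prune (P ∪ ⁅ p ⁆) (S ∷ kept) rest
    (λ { y (y∈S ∷ k) r → none y k (y∈S ∷ r) })
    -- The witness is new: `P` lies inside the unprocessed set `S`, and `p` does not.
    (≤-trans (s≤s len) (p⊂q⇒∣p∣<∣q∣ (p⊆p∪q ⁅ p ⁆ , p , x∈p∪q⁺ (inj₂ (x∈⁅x⁆ p)) , p∉S ∘ P⊆S)))
    ((S∈ , p , missS) ∷ All.zipWith extendKept (keptP , ck))
    (All.zipWith extendRest (restP , cr))
  where
  ck = ++⁻ˡ kept cp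
  cr = ++⁻ʳ kept cp

  p∉S : p ∉ S
  p∉S p∈S = none p ck (p∈S ∷ cr)

  missS : (P ∪ ⁅ p ⁆) ─ S ⊆ ⁅ p ⁆
  missS x∈ = [ (λ x∈P → contradiction (P⊆S x∈P) (x∈p─q⇒x∉q (P ∪ ⁅ p ⁆) S x∈)) , (λ x∈p → x∈p) ]′
    (x∈p∪q⁻ P ⁅ p ⁆ (p─q⊆p (P ∪ ⁅ p ⁆) S x∈))

  ∪⊆ : ∀ {T} → P ⊆ T → p ∈ T → P ∪ ⁅ p ⁆ ⊆ T
  ∪⊆ {T} P⊆T p∈T x∈ = [ P⊆T , (λ x∈p → subst (_∈ T) (sym (x∈⁅y⁆⇒x≡y p x∈p)) p∈T) ]′ (x∈p∪q⁻ P ⁅ p ⁆ x∈)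

  extendRest : ∀ {T} → (T ∈ₗ 𝒮 × P ⊆ T) × p ∈ T → T ∈ₗ 𝒮 × P ∪ ⁅ p ⁆ ⊆ T
  extendRest {T} ((T∈ , P⊆T) , p∈T) = T∈ , ∪⊆ {T} P⊆T p∈T

  extendKept : ∀ {T} → (T ∈ₗ 𝒮 × ∃[ q ] P ─ T ⊆ ⁅ q ⁆) × p ∈ T →
    T ∈ₗ 𝒮 × ∃[ q ] (P ∪ ⁅ p ⁆) ─ T ⊆ ⁅ q ⁆
  extendKept {T} ((T∈ , q , miss) , p∈T) = T∈ , q , λ {x} x∈ →
    let x∉T = x∈p─q⇒x∉q (P ∪ ⁅ p ⁆) T x∈ in
    [ (λ x∈P → miss (x∈p∧x∉q⇒x∈p─q x∈P x∉T))
    , (λ x∈p → contradiction (subst (_∈ T) (sym (x∈⁅y⁆⇒x≡y p x∈p)) p∈T) x∉T)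
    ]′ (x∈p∪q⁻ P ⁅ p ⁆ (p─q⊆p (P ∪ ⁅ p ⁆) T x∈))

-- The difference of the two sides is the square of `x - y`; ordering `x` and `y` first makes the
-- truncated subtraction exact.
4xy≤[x+y]² : ∀ x y → 4 * (x * y) ≤ (x + y) * (x + y)
4xy≤[x+y]² x y with ≤-total x y
... | inj₁ x≤y = subst (λ z → 4 * (x * z) ≤ (x + z) * (x + z)) (m+[n∸m]≡n x≤y)
  (≤-trans (m≤m+n _ ((y ∸ x) * (y ∸ x))) (≤-reflexive (expand x (y ∸ x))))
  where
  expand : ∀ x d → 4 * (x * (x + d)) + d * d ≡ (x + (x + d)) * (x + (x + d))
  expand = solve-∀
... | inj₂ y≤x = subst (λ z → 4 * (z * y) ≤ (z + y) * (z + y)) (m+[n∸m]≡n y≤x)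
  (≤-trans (m≤m+n _ ((x ∸ y) * (x ∸ y))) (≤-reflexive (expand y (x ∸ y))))
  where
  expand : ∀ y d → 4 * ((y + d) * y) + d * d ≡ ((y + d) + y) * ((y + d) + y)
  expand = solve-∀

∣⋃∣≤length*e : ∀ {n} {A : Set} (f : A → Subset n) e {xs} →
  All (λ x → ∣ f x ∣ ≤ e) xs → ∣ ⋃ (map f xs) ∣ ≤ length xs * e
∣⋃∣≤length*e {n} f e [] = ≤-reflexive (∣⊥∣≡0 n)
∣⋃∣≤length*e f e {x ∷ xs} (px ∷ pxs) =
  ≤-trans (∣p∪q∣≤∣p∣+∣q∣ (f x) (⋃ (map f xs))) (+-mono-≤ px (∣⋃∣≤length*e f e pxs))

-- A minimal subfamily without common vertex has m sets, each containing all but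
-- one of m witnesses P, so its union has at most m + m (r + 1 - m) vertices.
smallCore : ∀ {n} r (𝒮 : List (Subset n)) → Fin n → All (λ S → ∣ S ∣ ≤ r) 𝒮 → ¬ ∃ (Common 𝒮) →
  ∃[ W ] 4 * ∣ W ∣ ≤ (r + 2) * (r + 2) × (∀ c → ∃[ S ] S ∈ₗ 𝒮 × S ⊆ W × c ∉ S)
smallCore {n} r 𝒮 y₀ small none
  with prune {𝒮 = 𝒮} ⊥ [] 𝒮 (λ y _ cy → none (y , cy)) z≤n [] (All.tabulate (λ S∈ → S∈ , ⊥⊆))
... | Q , core , noneCore , len , coreP = W , bound , escape
  where
  open ≤-Reasoning
  m = ∣ Q ∣
  e = suc r ∸ m
  W = Q ∪ ⋃ (map (_─ Q) core)

  excess : All (λ S → ∣ S ─ Q ∣ + m ≤ suc r) core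
  excess = All.map (λ {S} (S∈ , p , miss) → begin
    ∣ S ─ Q ∣ + ∣ Q ∣   ≤⟨ ∣p─q∣+∣q∣≤∣p∣+∣q─p∣ S Q ⟩
    ∣ S ∣ + ∣ Q ─ S ∣   ≤⟨ +-mono-≤ (All.lookup small S∈)
                             (≤-trans (p⊆q⇒∣p∣≤∣q∣ miss) (≤-reflexive (∣⁅x⁆∣≡1 p))) ⟩
    r + 1               ≡⟨ +-comm r 1 ⟩
    suc r               ∎) coreP

  -- Needed for `e` to be a true difference. The core is not empty, since `y₀` would be common to an
  -- empty family, and any member gives the bound.
  m≤suc-r : ∀ {core} → ¬ ∃ (Common core) → All (λ S → ∣ S ─ Q ∣ + m ≤ suc r) core → m ≤ suc r
  m≤suc-r none [] = contradiction (y₀ , []) none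
  m≤suc-r _ (_∷_ {S} h _) = ≤-trans (m≤n+m m ∣ S ─ Q ∣) h

  sizeW : ∣ W ∣ ≤ m * suc e
  sizeW = begin
    ∣ W ∣                              ≤⟨ ∣p∪q∣≤∣p∣+∣q∣ Q _ ⟩
    m + ∣ ⋃ (map (_─ Q) core) ∣        ≤⟨ +-monoʳ-≤ m (∣⋃∣≤length*e (_─ Q) e
                                            (All.map (λ {S} → m+n≤o⇒m≤o∸n ∣ S ─ Q ∣) excess)) ⟩
    m + length core * e                ≤⟨ +-monoʳ-≤ m (*-monoˡ-≤ e len) ⟩
    m + m * e                          ≡⟨ *-suc m e ⟨
    m * suc e                          ∎

  m+suc-e≡r+2 : m + suc e ≡ r + 2
  m+suc-e≡r+2 = begin-equality
    m + suc e     ≡⟨ +-suc m e ⟩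
    suc (m + e)   ≡⟨ cong suc (m+[n∸m]≡n (m≤suc-r noneCore excess)) ⟩
    2 + r         ≡⟨ +-comm 2 r ⟩
    r + 2         ∎

  -- The factors `m` and `suc e` have the fixed sum `r + 2`, so their product is largest when they
  -- are equal; this is the origin of the square in the theorem.
  bound : 4 * ∣ W ∣ ≤ (r + 2) * (r + 2)
  bound = begin
    4 * ∣ W ∣                    ≤⟨ *-monoʳ-≤ 4 sizeW ⟩
    4 * (m * suc e)              ≤⟨ 4xy≤[x+y]² m (suc e) ⟩
    (m + suc e) * (m + suc e)    ≡⟨ cong (λ z → z * z) m+suc-e≡r+2 ⟩
    (r + 2) * (r + 2)            ∎

  escape : ∀ c → ∃[ S ] S ∈ₗ 𝒮 × S ⊆ W × c ∉ S
  escape c with find (¬All⇒Any¬ (c ∈?_) core (λ cc → noneCore (c , cc)))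
  ... | S , S∈core , c∉S = S , proj₁ (All.lookup coreP S∈core) , S⊆W , c∉S
    where
    S⊆W : S ⊆ W
    S⊆W {x} x∈S with x ∈? Q
    ... | yes x∈Q = x∈p∪q⁺ (inj₁ x∈Q)
    ... | no  x∉Q = x∈p∪q⁺ (inj₂ (⋃-upper (∈-map⁺ (_─ Q) S∈core) (x∈p∧x∉q⇒x∈p─q x∈S x∉Q)))

-- Vertex sets as concatenations of a `u`-part and a `v`-part.

∣p++q∣≡∣p∣+∣q∣ : ∀ {m n} (p : Subset m) (q : Subset n) → ∣ p ++ q ∣ ≡ ∣ p ∣ + ∣ q ∣
∣p++q∣≡∣p∣+∣q∣ [] q = refl
∣p++q∣≡∣p∣+∣q∣ (inside ∷ p) q = cong suc (∣p++q∣≡∣p∣+∣q∣ p q)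
∣p++q∣≡∣p∣+∣q∣ (outside ∷ p) q = ∣p++q∣≡∣p∣+∣q∣ p q

∈-++⁺ˡ : ∀ {m n} {p : Subset m} {q : Subset n} {x} → x ∈ p → x ↑ˡ n ∈ p ++ q
∈-++⁺ˡ {p = p} {q} {x} x∈ = lookup⇒[]= _ _ (trans (lookup-++ˡ p q x) ([]=⇒lookup x∈))

∈-++⁻ˡ : ∀ {m n} {p : Subset m} {q : Subset n} {x} → x ↑ˡ n ∈ p ++ q → x ∈ p
∈-++⁻ˡ {p = p} {q} {x} x∈ = lookup⇒[]= _ _ (trans (sym (lookup-++ˡ p q x)) ([]=⇒lookup x∈))

∈-++⁺ʳ : ∀ {m n} {p : Subset m} {q : Subset n} {x} → x ∈ q → m ↑ʳ x ∈ p ++ q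
∈-++⁺ʳ {p = p} {q} {x} x∈ = lookup⇒[]= _ _ (trans (lookup-++ʳ p q x) ([]=⇒lookup x∈))

∈-++⁻ʳ : ∀ {m n} {p : Subset m} {q : Subset n} {x} → m ↑ʳ x ∈ p ++ q → x ∈ q
∈-++⁻ʳ {p = p} {q} {x} x∈ = lookup⇒[]= _ _ (trans (sym (lookup-++ʳ p q x)) ([]=⇒lookup x∈))

++⁺-⊆ : ∀ {m n} {p p′ : Subset m} {q q′ : Subset n} → p ⊆ p′ → q ⊆ q′ → p ++ q ⊆ p′ ++ q′
++⁺-⊆ {p = []} {[]} _ q⊆q′ x∈ = q⊆q′ x∈
++⁺-⊆ {p = _ ∷ p} {_ ∷ p′} p⊆p′ q⊆q′ here with here ← p⊆p′ here = here
++⁺-⊆ {p = _ ∷ p} {_ ∷ p′} p⊆p′ q⊆q′ (there x∈) = there (++⁺-⊆ (drop-∷-⊆ p⊆p′) q⊆q′ x∈)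

++⁻-⊆ : ∀ {m n} {p p′ : Subset m} {q q′ : Subset n} → p ++ q ⊆ p′ ++ q′ → p ⊆ p′ × q ⊆ q′
++⁻-⊆ {p = p} {p′} {q} {q′} sub =
    (λ x∈ → ∈-++⁻ˡ {p = p′} {q′} (sub (∈-++⁺ˡ {p = p} {q} x∈)))
  , (λ x∈ → ∈-++⁻ʳ {p = p′} {q′} (sub (∈-++⁺ʳ {p = p} {q} x∈)))

-- Facets above a given face.

_≟ˢ_ : ∀ {m} (p q : Subset m) → Dec (p ≡ q)
_≟ˢ_ = ≡-dec Bool._≟_

p⊆q∧p≢q⇒∣p∣<∣q∣ : ∀ {m} {p q : Subset m} → p ⊆ q → q ≢ p → ∣ p ∣ < ∣ q ∣
p⊆q∧p≢q⇒∣p∣<∣q∣ {p = p} {q} p⊆q q≢p with p ⊂? q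
... | yes p⊂q = p⊂q⇒∣p∣<∣q∣ p⊂q
... | no  p⊄q = contradiction (⊆-antisym q⊆p p⊆q) q≢p
  where
  q⊆p : q ⊆ p
  q⊆p {x} x∈q = decidable-stable (x ∈? p) (λ x∉p → p⊄q (p⊆q , x , x∈q , x∉p))

-- Being a face is not assumed decidable, so the facet exists only up to double negation; that
-- suffices where a contradiction is sought. If no facet lies above `σ`, then `σ` is not maximal and
-- a larger face takes its place, at most `m ∸ ∣ σ ∣` times.
extendToFacet : ∀ {m} (Δ : Complex m) σ → Δ σ → ¬ ¬ (∃[ ρ ] σ ⊆ ρ × IsFacet Δ ρ)
extendToFacet {m} Δ σ Δσ = go (m ∸ ∣ σ ∣) σ Δσ (≤-reflexive (sym (m∸n+n≡m (∣p∣≤n σ))))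
  where
  go : ∀ fuel σ → Δ σ → m ≤ fuel + ∣ σ ∣ → ¬ ¬ (∃[ ρ ] σ ⊆ ρ × IsFacet Δ ρ)
  go fuel σ Δσ enough noFacet = noFacet (σ , (λ x∈ → x∈) , Δσ , maximal fuel enough)
    where
    maximal : ∀ fuel → m ≤ fuel + ∣ σ ∣ → ∀ ρ → Δ ρ → σ ⊆ ρ → ρ ≡ σ
    maximal fuel enough ρ Δρ σ⊆ρ = decidable-stable (ρ ≟ˢ σ) λ ρ≢σ →
      larger fuel enough (p⊆q∧p≢q⇒∣p∣<∣q∣ σ⊆ρ ρ≢σ)
      where
      larger : ∀ fuel → m ≤ fuel + ∣ σ ∣ → ∣ σ ∣ < ∣ ρ ∣ → False
      -- Without fuel `σ` already has all `m` vertices.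
      larger zero enough σ<ρ = <⇒≱ σ<ρ (≤-trans (∣p∣≤n ρ) enough)
      larger (suc fuel) enough σ<ρ = go fuel ρ Δρ
        (≤-trans enough (≤-trans (≤-reflexive (sym (+-suc fuel ∣ σ ∣))) (+-monoʳ-≤ fuel σ<ρ)))
        (λ (π , ρ⊆π , facet) → noFacet (π , (λ x∈ → ρ⊆π (σ⊆ρ x∈)) , facet))

-- The obstruction to purity.

Disjoint : ∀ {n} → Subset n → Subset n → Set
Disjoint p q = ∀ {x} → x ∈ p → x ∉ q

-- The counting argument freed from the complex. The hypothesis refuted is what purity would supply:
-- a partner of full size `p` for each `q`-set `B` missing `y`. As `n` is `p + q + 1`, such a pair
-- leaves out a single column.
obstruction : ∀ {n} p q r (𝒮 : List (Subset n)) (y : Fin n) → n ≡ suc (p + q) →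
  All (λ S → ∣ S ∣ ≤ r) 𝒮 → ¬ ∃ (Common 𝒮) → (r + 2) * (r + 2) ≤ 4 * p →
  ¬ (∀ B → ∣ B ∣ ≡ q → y ∉ B →
      ¬ ¬ (∃[ A ] Disjoint A B × ∣ A ∣ ≡ p × All (_⊈ A) 𝒮))
obstruction {n} p q r 𝒮 y n≡ small none r≤ extend with smallCore r 𝒮 y small none
... | W , W≤ , escape with subsetOfSize q (∁ (W ∪ ⁅ y ⁆)) room
  where
  open ≤-Reasoning
  -- `W` takes at most `p` columns and `y` the one in excess of `p + q`, so `q` columns remain for
  -- `B`.
  Wy≤ : ∣ W ∪ ⁅ y ⁆ ∣ ≤ suc p
  Wy≤ = begin
    ∣ W ∪ ⁅ y ⁆ ∣       ≤⟨ ∣p∪q∣≤∣p∣+∣q∣ W ⁅ y ⁆ ⟩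
    ∣ W ∣ + ∣ ⁅ y ⁆ ∣   ≤⟨ +-mono-≤ (*-cancelˡ-≤ 4 (≤-trans W≤ r≤)) (≤-reflexive (∣⁅x⁆∣≡1 y)) ⟩
    p + 1               ≡⟨ +-comm p 1 ⟩
    suc p               ∎
  room : q ≤ ∣ ∁ (W ∪ ⁅ y ⁆) ∣
  room = +-cancelˡ-≤ (suc p) q _ (begin
    suc p + q                                 ≡⟨ n≡ ⟨
    n                                         ≡⟨ ∣p∣+∣∁p∣≡n (W ∪ ⁅ y ⁆) ⟨
    ∣ W ∪ ⁅ y ⁆ ∣ + ∣ ∁ (W ∪ ⁅ y ⁆) ∣         ≤⟨ +-monoˡ-≤ _ Wy≤ ⟩
    suc p + ∣ ∁ (W ∪ ⁅ y ⁆) ∣                 ∎)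
... | B , B⊆ , ∣B∣≡q = extend B ∣B∣≡q (λ y∈B → x∈∁p⇒x∉p (B⊆ y∈B) (x∈p∪q⁺ (inj₂ (x∈⁅x⁆ y)))) refute
  where
  refute : ¬ (∃[ A ] Disjoint A B × ∣ A ∣ ≡ p × All (_⊈ A) 𝒮)
  refute (A , dis , ∣A∣≡p , avoid) with ∣p∣≡1⇒singleton (∁ (A ∪ B)) one
    where
    ∣A∪B∣ : ∣ A ∪ B ∣ ≡ p + q
    ∣A∪B∣ = trans (≤-antisym (∣p∪q∣≤∣p∣+∣q∣ A B) (∣p∣+∣q∣≤∣p∪q∣ A B dis)) (cong₂ _+_ ∣A∣≡p ∣B∣≡q)
    one : ∣ ∁ (A ∪ B) ∣ ≡ 1
    one = +-cancelˡ-≡ (p + q) _ 1 (trans (cong (_+ ∣ ∁ (A ∪ B) ∣) (sym ∣A∪B∣))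
      (trans (∣p∣+∣∁p∣≡n (A ∪ B)) (trans n≡ (+-comm 1 (p + q)))))
  -- `W` and `B` were fixed before `A` was known; only the choice of `S` depends on the omitted
  -- column `c`.
  ... | c , only with escape c
  ... | S , S∈𝒮 , S⊆W , c∉S = All.lookup avoid S∈𝒮 S⊆A
    where
    S⊆A : S ⊆ A
    S⊆A {x} x∈S with x ∈? A ∪ B
    ... | no  x∉ = contradiction (subst (_∈ S) (only (x∉p⇒x∈∁p x∉)) x∈S) c∉S
    ... | yes x∈ = [ (λ x∈A → x∈A)
                   , (λ x∈B → contradiction (x∈p∪q⁺ (inj₁ (S⊆W x∈S))) (x∈∁p⇒x∉p (B⊆ x∈B))) ]′
                   (x∈p∪q⁻ A B x∈)

-- Shedding, seen on pairs of vertex sets.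

-- A face with u-part A and v-part B is written F A B; the two sides are
-- interchanged by flip.
FaceRel : ℕ → Set₁
FaceRel n = Subset n → Subset n → Set

record Bounded {n} (p q : ℕ) (F : FaceRel n) : Set where
  field
    disjoint : ∀ {A B} → F A B → Disjoint A B
    left≤    : ∀ {A B} → F A B → ∣ A ∣ ≤ p
    right≤   : ∀ {A B} → F A B → ∣ B ∣ ≤ q

Extendable : ∀ {n} → ℕ → FaceRel n → Set
Extendable d F = ∀ {A B} → F A B →
  ¬ ¬ (∃[ A′ ] ∃[ B′ ] A ⊆ A′ × B ⊆ B′ × F A′ B′ × ∣ A′ ∣ + ∣ B′ ∣ ≡ d)

-- The family `𝒮` stands for the shed faces lying entirely on the first side. For a `Bounded`
-- relation the two fields determine exactly which `A` are faces on their own.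
record OneSided {n} (p : ℕ) (F : FaceRel n) (𝒮 : List (Subset n)) : Set where
  field
    avoids   : ∀ {A B} → F A B → All (_⊈ A) 𝒮
    contains : ∀ {A} → ∣ A ∣ ≤ p → All (_⊈ A) 𝒮 → F A ⊥

open Bounded
open OneSided

Bounded-flip : ∀ {n p q} {F : FaceRel n} → Bounded p q F → Bounded q p (flip F)
Bounded-flip bd = record
  { disjoint = λ f x∈A x∈B → disjoint bd f x∈B x∈A
  ; left≤ = right≤ bd ; right≤ = left≤ bd }

Extendable-flip : ∀ {n p q} {F : FaceRel n} → Extendable (p + q) F → Extendable (q + p) (flip F)
Extendable-flip {p = p} {q} ext f no-ext = ext f λ (A , B , A⊆ , B⊆ , f′ , eq) →
  no-ext (B , A , B⊆ , A⊆ , f′ , trans (+-comm ∣ B ∣ ∣ A ∣) (trans eq (+-comm p q)))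

Common⇒⊈ : ∀ {n} {𝒮 : List (Subset n)} {y A} → Common 𝒮 y → y ∉ A → All (_⊈ A) 𝒮
Common⇒⊈ cy y∉A = All.map (λ y∈S S⊆A → y∉A (S⊆A y∈S)) cy

-- Each set of `𝒯` contains `y`, so every `q`-set missing `y` is still a face. Extending it to full
-- size gives the partner that `obstruction` excludes.
commonPersists : ∀ {n p q r} {F : FaceRel n} {𝒮 𝒯} → n ≡ suc (p + q) →
  Bounded p q F → Extendable (p + q) F → OneSided p F 𝒮 → OneSided q (flip F) 𝒯 →
  All (λ S → ∣ S ∣ ≤ r) 𝒮 → (r + 2) * (r + 2) ≤ 4 * p → ∃ (Common 𝒯) → ¬ ¬ ∃ (Common 𝒮)
commonPersists {p = p} {q} {r} {𝒮 = 𝒮} n≡ bd ext sideS sideT small r≤ (y , cy) none =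
  obstruction p q r 𝒮 y n≡ small none r≤ λ B ∣B∣≡q y∉B fail →
    ext (contains sideT (≤-reflexive ∣B∣≡q) (Common⇒⊈ cy y∉B)) λ (A , B′ , _ , B⊆B′ , f , eq) →
      fail (A , (λ x∈A x∈B → disjoint bd f x∈A (B⊆B′ x∈B))
              , ≤-antisym (left≤ bd f)
                  -- The total size is `p + q` and the second part takes at most `q`, so the first
                  -- part has at least `p`.
                  (+-cancelʳ-≤ q p ∣ A ∣ (≤-trans (≤-reflexive (sym eq)) (+-monoʳ-≤ ∣ A ∣ (right≤ bd f))))
              , avoids sideS f)

-- An equivalence of predicates, so that interchanging the sides of a deletion yields another
-- instance although concatenation is not symmetric.
Sheds : ∀ {n} → Subset n → Subset n → (F F′ : FaceRel n) → Set
Sheds S T F F′ = ∀ {A B} →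
  (F′ A B → F A B × ¬ (S ⊆ A × T ⊆ B)) × (F A B → ¬ (S ⊆ A × T ⊆ B) → F′ A B)

Sheds-flip : ∀ {n} {S T : Subset n} {F F′} → Sheds S T F F′ → Sheds T S (flip F) (flip F′)
Sheds-flip sh =
    (λ f′ → proj₁ (proj₁ sh f′) , λ (t , s) → proj₂ (proj₁ sh f′) ((λ {x} → s {x}) , (λ {x} → t {x})))
  , (λ f no-st → proj₂ sh f λ (s , t) → no-st ((λ {x} → t {x}) , (λ {x} → s {x})))

Bounded-shed : ∀ {n p q S T} {F F′ : FaceRel n} → Sheds S T F F′ → Bounded p q F → Bounded p q F′
Bounded-shed sh bd = record
  { disjoint = λ f′ → disjoint bd (proj₁ (proj₁ sh f′))
  ; left≤    = λ f′ → left≤ bd (proj₁ (proj₁ sh f′))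
  ; right≤   = λ f′ → right≤ bd (proj₁ (proj₁ sh f′)) }

-- A shed face with a vertex on the second side is contained in no face that lies on the first side
-- only.
OneSided-keep : ∀ {n p S T 𝒮} {F F′ : FaceRel n} → Sheds S T F F′ → Nonempty T →
  OneSided p F 𝒮 → OneSided p F′ 𝒮
OneSided-keep sh (t , t∈T) side = record
  { avoids   = λ f′ → avoids side (proj₁ (proj₁ sh f′))
  ; contains = λ A≤ av → proj₂ sh (contains side A≤ av) λ (_ , T⊆⊥) → ∉⊥ (T⊆⊥ t∈T) }

OneSided-add : ∀ {n p S T 𝒮} {F F′ : FaceRel n} → Sheds S T F F′ → Empty T →
  OneSided p F 𝒮 → OneSided p F′ (S ∷ 𝒮)
OneSided-add sh T∅ side = record
  { avoids   = λ f′ → (λ S⊆A → proj₂ (proj₁ sh f′)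
                        ((λ {x} → S⊆A {x}) , λ t∈T → contradiction (_ , t∈T) T∅))
                      ∷ avoids side (proj₁ (proj₁ sh f′))
  ; contains = λ { A≤ (S⊈A ∷ av) →
      proj₂ sh (contains side A≤ av) λ (S⊆A , _) → S⊈A (λ {x} → S⊆A {x}) } }

-- Complexes as face relations, and the induction over the shedding sequence.

Faces : ∀ n → Complex (n + n) → FaceRel n
Faces n Δ A B = Δ (A ++ B)

Split : ∀ {n} → Subset (n + n) → Set
Split {n} σ = ∃[ A ] ∃[ B ] σ ≡ _++_ {m = n} {n = n} A B

split : ∀ {n} (σ : Subset (n + n)) → Split {n} σ
split {n} σ = take n σ , drop n σ , sym (take++drop≡id n σ)

pure⇒extendable : ∀ {n d} {Δ : Complex (n + n)} → PureOfDim d Δ → Extendable d (Faces n Δ)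
pure⇒extendable {n} {Δ = Δ} (_ , pure) {A} {B} f no-ext =
  extendToFacet Δ (A ++ B) f λ (ρ , sub , facet) → splitFacet ρ sub facet (split {n} ρ)
  where
  splitFacet : ∀ ρ → A ++ B ⊆ ρ → IsFacet Δ ρ → Split {n} ρ → False
  splitFacet ρ sub facet (A′ , B′ , refl) =
    no-ext (A′ , B′ , proj₁ (++⁻-⊆ {p = A} {A′} {B} {B′} sub)
           , proj₂ (++⁻-⊆ {p = A} {A′} {B} {B′} sub)
           , proj₁ facet , trans (sym (∣p++q∣≡∣p∣+∣q∣ A′ B′)) (pure _ facet))

Sheds-∖ : ∀ {n} (Δ : Complex (n + n)) (S T : Subset n) → Sheds S T (Faces n Δ) (Faces n (Δ ∖ (S ++ T)))
Sheds-∖ {n} Δ S T {A} {B} =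
    (λ (f , out) → f , λ (s , t) → out (++⁺-⊆ {p = S} {A} {T} {B} s t))
  , (λ f out → f , λ sub → out (++⁻-⊆ {p = S} {A} {T} {B} sub))

-- A single facet would contain every vertex of the complex. For `x` other than `y`, no set of `𝒮`
-- fits into `⁅ x ⁆`, so `x` is still a vertex; this makes `p + q` vertices on a side that admits
-- only `p`.
¬simplex : ∀ {n p q 𝒮} {Δ : Complex (n + n)} → n ≡ suc (p + q) → 1 ≤ p → 1 ≤ q →
  Bounded p q (Faces n Δ) → OneSided p (Faces n Δ) 𝒮 → ∃ (Common 𝒮) → ¬ IsSimplex Δ
¬simplex {n} {p} {q} {𝒮} {Δ} n≡ 1≤p 1≤q bd side (y , cy) (σ , facet , unique) = contra (split {n} σ)
  where
  open ≤-Reasoning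
  contra : Split {n} σ → False
  contra (A , B , refl) = <⇒≱ (m<m+n p 1≤q) (begin
    p + q           ≡⟨ suc-injective (trans (sym n≡) (trans (sym (∣p∣+∣∁p∣≡n ⁅ y ⁆))
                         (cong (_+ ∣ ∁ ⁅ y ⁆ ∣) (∣⁅x⁆∣≡1 y)))) ⟩
    ∣ ∁ ⁅ y ⁆ ∣     ≤⟨ p⊆q⇒∣p∣≤∣q∣ rest⊆A ⟩
    ∣ A ∣           ≤⟨ left≤ bd {A} {B} (proj₁ facet) ⟩
    p               ∎)
    where
    rest⊆A : ∁ ⁅ y ⁆ ⊆ A
    rest⊆A {x} x∈ = decidable-stable (x ∈? A) λ x∉A →
      extendToFacet Δ (⁅ x ⁆ ++ ⊥)
        (contains side (≤-trans (≤-reflexive (∣⁅x⁆∣≡1 x)) 1≤p)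
          (Common⇒⊈ cy λ y∈x → x∈∁p⇒x∉p x∈ (subst (_∈ ⁅ y ⁆) (x∈⁅y⁆⇒x≡y x y∈x) (x∈⁅x⁆ y))))
        λ (ρ , sub , facetρ) → x∉A
          (∈-++⁻ˡ {p = A} {B} (subst (x ↑ˡ n ∈_) (unique ρ facetρ)
            (sub (∈-++⁺ˡ {p = ⁅ x ⁆} {⊥} (x∈⁅x⁆ x)))))

-- The invariant is that both families have a common vertex. A shed face enlarges at most one
-- family, and the common vertex of the other one is what `commonPersists` needs. Shed faces have at
-- most `k + 1` vertices, so `r + 2` becomes `k + 3`.
¬weaklyDecomposable : ∀ {n p q k} {Δ : Complex (n + n)} {𝒮 𝒯} → n ≡ suc (p + q) → 1 ≤ p → 1 ≤ q →
  (k + 1 + 2) * (k + 1 + 2) ≤ 4 * p → (k + 1 + 2) * (k + 1 + 2) ≤ 4 * q →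
  Bounded p q (Faces n Δ) → OneSided p (Faces n Δ) 𝒮 → OneSided q (flip (Faces n Δ)) 𝒯 →
  All (λ S → ∣ S ∣ ≤ k + 1) 𝒮 → All (λ T → ∣ T ∣ ≤ k + 1) 𝒯 →
  ∃ (Common 𝒮) → ∃ (Common 𝒯) → ¬ WeaklyDecomposable k (p + q) Δ
¬weaklyDecomposable n≡ 1≤p 1≤q _ _ bd sideS _ _ _ comS _ (simplex _ simp) =
  ¬simplex n≡ 1≤p 1≤q bd sideS comS simp
¬weaklyDecomposable {n} {p} {q} {k} {Δ} {𝒮} {𝒯} n≡ 1≤p 1≤q k≤p k≤q bd sideS sideT smallS smallT comS comT
  (shed _ τ _ τ≤ pure′ dec) = step (split {n} τ)
  where
  step : Split {n} τ → False
  step (S , T , refl) = cases (nonempty? S) (nonempty? T)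
    where
    sh : Sheds S T (Faces n Δ) (Faces n (Δ ∖ (S ++ T)))
    sh {A} {B} = Sheds-∖ Δ S T {A} {B}
    hs : Sheds T S (flip (Faces n Δ)) (flip (Faces n (Δ ∖ (S ++ T))))
    hs {A} {B} = Sheds-flip {F = Faces n Δ} (λ {A} {B} → sh {A} {B}) {A} {B}
    bd′ = Bounded-shed {F = Faces n Δ} {F′ = Faces n (Δ ∖ (S ++ T))} (λ {A} {B} → sh {A} {B}) bd
    ext′ : Extendable (p + q) (Faces n (Δ ∖ (S ++ T)))
    -- Purity is taken from the deletion, the complex that the enlarged family describes.
    ext′ = pure⇒extendable pure′
    n≡′ : n ≡ suc (q + p)
    n≡′ = trans n≡ (cong suc (+-comm p q))
    S+T≤ : ∣ S ∣ + ∣ T ∣ ≤ k + 1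
    S+T≤ = subst (_≤ k + 1) (∣p++q∣≡∣p∣+∣q∣ S T) τ≤
    smallS′ = ≤-trans (m≤m+n ∣ S ∣ ∣ T ∣) S+T≤ ∷ smallS
    smallT′ = ≤-trans (m≤n+m ∣ T ∣ ∣ S ∣) S+T≤ ∷ smallT

    keepS : Nonempty T → OneSided p (Faces n (Δ ∖ (S ++ T))) 𝒮
    keepS ne = OneSided-keep {F = Faces n Δ} (λ {A} {B} → sh {A} {B}) ne sideS
    keepT : Nonempty S → OneSided q (flip (Faces n (Δ ∖ (S ++ T)))) 𝒯
    keepT ne = OneSided-keep {F = flip (Faces n Δ)} (λ {A} {B} → hs {A} {B}) ne sideT
    addS : Empty T → OneSided p (Faces n (Δ ∖ (S ++ T))) (S ∷ 𝒮)
    addS em = OneSided-add {F = Faces n Δ} (λ {A} {B} → sh {A} {B}) em sideS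
    addT : Empty S → OneSided q (flip (Faces n (Δ ∖ (S ++ T)))) (T ∷ 𝒯)
    addT em = OneSided-add {F = flip (Faces n Δ)} (λ {A} {B} → hs {A} {B}) em sideT

    cases : Dec (Nonempty S) → Dec (Nonempty T) → False
    cases (yes neS) (yes neT) =
      ¬weaklyDecomposable n≡ 1≤p 1≤q k≤p k≤q bd′ (keepS neT) (keepT neS) smallS smallT comS comT dec
    cases (yes neS) (no T∅) =
      commonPersists {F = Faces n (Δ ∖ (S ++ T))} n≡ bd′ ext′
        (addS T∅) (keepT neS) smallS′ k≤p comT λ comS′ →
        ¬weaklyDecomposable n≡ 1≤p 1≤q k≤p k≤q bd′ (addS T∅) (keepT neS) smallS′ smallT comS′ comT dec
    cases (no S∅) (yes neT) =
      commonPersists {F = flip (Faces n (Δ ∖ (S ++ T)))} n≡′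
        (Bounded-flip bd′) (Extendable-flip {p = p} {F = Faces n (Δ ∖ (S ++ T))} ext′)
        (addT S∅) (keepS neT) smallT′ k≤q comS λ comT′ →
        ¬weaklyDecomposable n≡ 1≤p 1≤q k≤p k≤q bd′ (keepS neT) (addT S∅) smallS smallT′ comS comT′ dec
    -- Deleting the empty face would leave no face at all, whereas `pure′` provides one.
    cases (no S∅) (no T∅) =
      let ((σ , (_ , τ⊈σ) , _) , _) = pure′
          (A , B , σ≡) = split {n} σ
      in
      τ⊈σ (subst (S ++ T ⊆_) (sym σ≡) (++⁺-⊆ {p = S} {A} {T} {B}
        (λ x∈ → contradiction (_ , x∈) S∅) (λ x∈ → contradiction (_ , x∈) T∅)))

-- Natural numbers inside the rationals, and bounds from row sums.

toℚᵘ-ℕ→ℚ : ∀ k → ℚ.toℚᵘ (ℕ→ℚ k) ℚᵘ.≃ mkℚᵘ (ℤ.+ k) 0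
toℚᵘ-ℕ→ℚ k = ℚ.toℚᵘ-fromℚᵘ (mkℚᵘ (ℤ.+ k) 0)

ℕ→ℚ-+ : ∀ m n → ℕ→ℚ (m + n) ≡ ℕ→ℚ m ℚ.+ ℕ→ℚ n
ℕ→ℚ-+ m n = ℚ.toℚᵘ-injective (begin
  ℚ.toℚᵘ (ℕ→ℚ (m + n))                      ≈⟨ toℚᵘ-ℕ→ℚ (m + n) ⟩
  mkℚᵘ (ℤ.+ (m + n)) 0                        ≈⟨ *≡* (cong (ℤ._* (ℤ.+ 1))
    (cong₂ ℤ._+_ (sym (ℤ.*-identityʳ (ℤ.+ m))) (sym (ℤ.*-identityʳ (ℤ.+ n))))) ⟩
  mkℚᵘ (ℤ.+ m) 0 ℚᵘ.+ mkℚᵘ (ℤ.+ n) 0             ≈⟨ ℚᵘ.+-cong (toℚᵘ-ℕ→ℚ m) (toℚᵘ-ℕ→ℚ n) ⟨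
  ℚ.toℚᵘ (ℕ→ℚ m) ℚᵘ.+ ℚ.toℚᵘ (ℕ→ℚ n)         ≈⟨ ℚ.toℚᵘ-homo-+ (ℕ→ℚ m) (ℕ→ℚ n) ⟨
  ℚ.toℚᵘ (ℕ→ℚ m ℚ.+ ℕ→ℚ n)                  ∎)
  where open import Relation.Binary.Reasoning.Setoid ℚᵘ.≃-setoid

ℕ→ℚ-cancel-≤ : ∀ {m n} → ℕ→ℚ m ℚ.≤ ℕ→ℚ n → m ≤ n
ℕ→ℚ-cancel-≤ {m} {n} le = ℤ.drop‿+≤+ (ℤ.*-cancelʳ-≤-pos (ℤ.+ m) (ℤ.+ n) (ℤ.+ 1)
  (ℚᵘ.drop-*≤* (ℚᵘ.≤-respʳ-≃ (toℚᵘ-ℕ→ℚ n) (ℚᵘ.≤-respˡ-≃ (toℚᵘ-ℕ→ℚ m) (ℚ.toℚᵘ-mono-≤ le)))))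

0≤ℕ→ℚ : ∀ k → 0ℚ ℚ.≤ ℕ→ℚ k
0≤ℕ→ℚ k = ℚ.toℚᵘ-cancel-≤ (ℚᵘ.≤-respʳ-≃ (ℚᵘ.≃-sym (toℚᵘ-ℕ→ℚ k))
  (*≤* (ℤ.*-monoʳ-≤-nonNeg (ℤ.+ 1) {ℤ.+ 0} {ℤ.+ k} (+≤+ z≤n))))

-- Meant for the row opposite to the prescribed zeros, where each of these columns has the full
-- entry 2.
2∣p∣≤sumℚ : ∀ {n} (p : Subset n) (f : Fin n → ℚ) → (∀ ν → 0ℚ ℚ.≤ f ν) →
  (∀ ν → ν ∈ p → f ν ≡ ℕ→ℚ 2) → ℕ→ℚ (∣ p ∣ * 2) ℚ.≤ sumℚ f
2∣p∣≤sumℚ [] f _ _ = ℚ.≤-refl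
2∣p∣≤sumℚ (inside ∷ p) f f≥0 f≡2 = ℚ.≤-trans (ℚ.≤-reflexive (ℕ→ℚ-+ 2 (∣ p ∣ * 2)))
  (ℚ.+-mono-≤ (ℚ.≤-reflexive (sym (f≡2 fzero here)))
    (2∣p∣≤sumℚ p (f ∘ fsuc) (f≥0 ∘ fsuc) (λ ν ν∈ → f≡2 (fsuc ν) (there ν∈))))
2∣p∣≤sumℚ (outside ∷ p) f f≥0 f≡2 = ℚ.≤-trans (ℚ.≤-reflexive (sym (ℚ.+-identityˡ _)))
  (ℚ.+-mono-≤ (f≥0 fzero) (2∣p∣≤sumℚ p (f ∘ fsuc) (f≥0 ∘ fsuc) (λ ν ν∈ → f≡2 (fsuc ν) (there ν∈))))

-- Parity: an odd row sum `2 * c + 1` has room for `c` entries 2 and no more.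
m*2≤2c+1⇒m≤c : ∀ {m c} → m * 2 ≤ 2 * c + 1 → m ≤ c
m*2≤2c+1⇒m≤c {m} {c} le = ≮⇒≥ λ c<m → <⇒≱ (begin-strict
  2 * c + 1   <⟨ ≤-reflexive (sym (trans (+-comm (2 * c) 2) (cong suc (+-comm 1 (2 * c))))) ⟩
  2 * c + 2   ≡⟨ trans (cong (_+ 2) (*-comm 2 c)) (+-comm (c * 2) 2) ⟩
  suc c * 2   ≤⟨ *-monoˡ-≤ 2 c<m ⟩
  m * 2       ∎) le
  where open ≤-Reasoning

-- Integral points of the transportation polytope.

-- An integral point of the transportation polytope, given by its two rows (in either
-- order); p is the part of a face that forces zeros in the second of them.
Filling : ∀ {n} → Subset n → ℕ → ℕ → Set
Filling {n} p s t = ∃[ g ] ∃[ h ] (∀ (ν : Fin n) → g ν + h ν ≡ 2)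
  × sumℚ (ℕ→ℚ ∘ g) ≡ ℕ→ℚ s × sumℚ (ℕ→ℚ ∘ h) ≡ ℕ→ℚ t × (∀ ν → ν ∈ p → h ν ≡ 0)

fillColumn : ∀ {n p} s t side x y → x + y ≡ 2 → (side ≡ inside → y ≡ 0) →
  Filling {n} p s t → Filling {suc n} (side ∷ p) (x + s) (y + t)
fillColumn s t side x y x+y≡2 y≡0 (g , h , col , sg , sh , zeros) =
  x ◂ g , y ◂ h
  , (λ { fzero → x+y≡2 ; (fsuc ν) → col ν })
  , trans (cong (ℕ→ℚ x ℚ.+_) sg) (sym (ℕ→ℚ-+ x s))
  , trans (cong (ℕ→ℚ y ℚ.+_) sh) (sym (ℕ→ℚ-+ y t))
  , λ { fzero here → y≡0 refl ; (fsuc ν) (there ν∈) → zeros ν ν∈ }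

-- Greedy, column by column: a column of `p` gets 2 in the first row, any other column gets as much
-- of `t` as it can hold. The first row thus keeps enough for the columns of `p` still to come.
fill : ∀ {n} (p : Subset n) s t → s + t ≡ n * 2 → ∣ p ∣ * 2 ≤ s → Filling p s t
fill [] zero zero _ _ = (λ ()) , (λ ()) , (λ ()) , refl , refl , λ ()
fill (inside ∷ p) (suc (suc s)) t s+t≡ (s≤s (s≤s p≤)) =
  fillColumn {p = p} s t inside 2 0 refl (λ _ → refl) (fill p s t (suc-injective (suc-injective s+t≡)) p≤)
fill {suc n} (outside ∷ p) s (suc (suc t)) s+t≡ p≤ =
  fillColumn {p = p} s t outside 0 2 refl (λ ())
    (fill p s t (+-cancelˡ-≡ 2 (s + t) (n * 2)
      (trans (sym (trans (+-suc s (suc t)) (cong suc (+-suc s t)))) s+t≡)) p≤)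
fill {suc n} (outside ∷ p) zero (suc zero) () p≤
-- The mixed column uses up an odd `t`. Then `s` alone fills the remaining `n` columns, which is
-- enough for any `p`.
fill {suc n} (outside ∷ p) (suc s) (suc zero) s+t≡ p≤ =
  fillColumn {p = p} s 0 outside 1 1 refl (λ ())
    (fill p s 0 s+0≡ (≤-trans (*-monoˡ-≤ 2 (∣p∣≤n p)) (≤-reflexive (trans (sym s+0≡) (+-identityʳ s)))))
  where
  s+0≡ : s + 0 ≡ n * 2
  s+0≡ = suc-injective (suc-injective (trans (cong suc (sym (+-suc s 0))) s+t≡))
fill {suc n} (outside ∷ p) (suc (suc s)) zero s+t≡ p≤ =
  fillColumn {p = p} s 0 outside 2 0 refl (λ _ → refl)
    (fill p s 0 s+0≡ (≤-trans (*-monoˡ-≤ 2 (∣p∣≤n p)) (≤-reflexive (trans (sym s+0≡) (+-identityʳ s)))))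
  where
  s+0≡ : s + 0 ≡ n * 2
  s+0≡ = suc-injective (suc-injective s+t≡)

-- The one-sided faces and size bounds of Δ(a,b).

module _ (a b : ℕ) where
  private
    N = a + b + 1

  -- The bounds are crossed: zeros in the first row force entries 2 in the second, whose sum is
  -- `2 * b + 1`, and conversely. A column in both parts would have sum 0.
  Δab-bounded : Bounded b a (Faces N (Δab a b))
  Δab-bounded = record
    { disjoint = λ {A} {B} (X , (_ , _ , _ , col) , u0 , v0) {ν} ν∈A ν∈B →
        contradiction (trans (sym (col ν)) (cong₂ ℚ._+_ (u0 ν (∈-++⁺ˡ {p = A} {B} ν∈A))
                                                        (v0 ν (∈-++⁺ʳ {p = A} {B} ν∈B)))) λ ()
    ; left≤ = λ {A} {B} (X , (pos , _ , row2 , col) , u0 , v0) →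
        m*2≤2c+1⇒m≤c (ℕ→ℚ-cancel-≤ (ℚ.≤-trans
          (2∣p∣≤sumℚ A (X (fsuc fzero)) (pos (fsuc fzero)) λ ν ν∈A →
            trans (sym (ℚ.+-identityˡ _)) (trans
              (cong (ℚ._+ X (fsuc fzero) ν) (sym (u0 ν (∈-++⁺ˡ {p = A} {B} ν∈A)))) (col ν)))
          (ℚ.≤-reflexive row2)))
    ; right≤ = λ {A} {B} (X , (pos , row1 , _ , col) , u0 , v0) →
        m*2≤2c+1⇒m≤c (ℕ→ℚ-cancel-≤ (ℚ.≤-trans
          (2∣p∣≤sumℚ B (X fzero) (pos fzero) λ ν ν∈B →
            trans (sym (ℚ.+-identityʳ _)) (trans
              (cong (X fzero ν ℚ.+_) (sym (v0 ν (∈-++⁺ʳ {p = A} {B} ν∈B)))) (col ν)))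
          (ℚ.≤-reflexive row1)))
    }

  rowSums : (2 * a + 1) + (2 * b + 1) ≡ N * 2
  rowSums = identity a b
    where
    identity : ∀ a b → (2 * a + 1) + (2 * b + 1) ≡ (a + b + 1) * 2
    identity = solve-∀

  m≤c⇒m*2≤2c+1 : ∀ {m c} → m ≤ c → m * 2 ≤ 2 * c + 1
  m≤c⇒m*2≤2c+1 {m} {c} m≤c =
    ≤-trans (*-monoˡ-≤ 2 m≤c) (≤-trans (≤-reflexive (*-comm c 2)) (m≤m+n (2 * c) 1))

  -- The `u`-vertices demand zeros in the first row of the matrix, so that row is taken to be `h`.
  Δab-left : OneSided b (Faces N (Δab a b)) []
  Δab-left = record
    { avoids   = λ _ → []
    ; contains = λ {A} A≤b _ → point A (fill A (2 * b + 1) (2 * a + 1)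
        (trans (+-comm (2 * b + 1) (2 * a + 1)) rowSums) (m≤c⇒m*2≤2c+1 A≤b)) }
    where
    point : ∀ A → Filling A (2 * b + 1) (2 * a + 1) → Δab a b (A ++ ⊥)
    point A (g , h , col , sg , sh , zeros) =
      (λ { fzero → ℕ→ℚ ∘ h ; (fsuc _) → ℕ→ℚ ∘ g })
      , ( (λ { fzero ν → 0≤ℕ→ℚ (h ν) ; (fsuc _) ν → 0≤ℕ→ℚ (g ν) }) , sh , sg
        , λ ν → trans (sym (ℕ→ℚ-+ (h ν) (g ν))) (cong ℕ→ℚ (trans (+-comm (h ν) (g ν)) (col ν))))
      , (λ ν ν∈ → cong ℕ→ℚ (zeros ν (∈-++⁻ˡ {p = A} {⊥} ν∈)))
      , λ ν ν∈ → contradiction (∈-++⁻ʳ {p = A} {⊥} ν∈) ∉⊥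

  Δab-right : OneSided a (flip (Faces N (Δab a b))) []
  Δab-right = record
    { avoids   = λ _ → []
    ; contains = λ {B} B≤a _ → point B (fill B (2 * a + 1) (2 * b + 1)
        rowSums (m≤c⇒m*2≤2c+1 B≤a)) }
    where
    point : ∀ B → Filling B (2 * a + 1) (2 * b + 1) → Δab a b (⊥ {n = N} ++ B)
    point B (g , h , col , sg , sh , zeros) =
      (λ { fzero → ℕ→ℚ ∘ g ; (fsuc _) → ℕ→ℚ ∘ h })
      , ( (λ { fzero ν → 0≤ℕ→ℚ (g ν) ; (fsuc _) ν → 0≤ℕ→ℚ (h ν) }) , sg , sh
        , λ ν → trans (sym (ℕ→ℚ-+ (g ν) (h ν))) (cong ℕ→ℚ (col ν)))
      , (λ ν ν∈ → contradiction (∈-++⁻ˡ {p = ⊥ {n = N}} {B} ν∈) ∉⊥)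
      , λ ν ν∈ → cong ℕ→ℚ (zeros ν (∈-++⁻ʳ {p = ⊥ {n = N}} {B} ν∈))

theorem3p4 : (a b k : ℕ) → 1 ≤ a → 1 ≤ b
    → (k + 3) * (k + 3) ≤ 4 * (a ⊓ b)
    → ¬ WeaklyDecomposable {(a + b + 1) + (a + b + 1)} k (a + b) (Δab a b)
theorem3p4 a b k 1≤a 1≤b k≤ dec =
  ¬weaklyDecomposable {p = b} {a} {k} size 1≤b 1≤a
    (k+1+2≤ (m⊓n≤n a b)) (k+1+2≤ (m⊓n≤m a b))
    -- Before any shedding both families are empty, and any vertex is common to an empty family.
    (Δab-bounded a b) (Δab-left a b) (Δab-right a b) [] [] (vertex , []) (vertex , [])
    (subst (λ d → WeaklyDecomposable k d (Δab a b)) (+-comm a b) dec)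
  where
  size : a + b + 1 ≡ suc (b + a)
  size = trans (+-comm (a + b) 1) (cong suc (+-comm a b))

  vertex : Fin (a + b + 1)
  vertex = (a + b) ↑ʳ fzero

  k+1+2≤ : ∀ {c} → a ⊓ b ≤ c → (k + 1 + 2) * (k + 1 + 2) ≤ 4 * c
  k+1+2≤ a⊓b≤c =
    ≤-trans (≤-reflexive (cong (λ z → z * z) (+-assoc k 1 2))) (≤-trans k≤ (*-monoʳ-≤ 4 a⊓b≤c))
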